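{- Let $r\ge 3$ and let $G$ be a finite graph with bipartite induced matching number $t$. For any family $\mathcal{G}\subseteq \mathcal{C}(G)$, if $\mathcal{G}$ has the $(r,2)$-property, then $\tau(\mathcal{G})\le C(r,t)$ for some constant $C(r,t)$ depending only on $r$ and $t$. In particular, if $G$ is $\alpha$-ultra maximal $K_r$-free for some $\alpha>0$, then $\tau(\mathcal{G})\le C'(r,\alpha)$ for some constant depending only on $r$ and $\alpha$.
   Context: Let $\mathrm{MIS}(G)$ be the set of all maximal independent sets of $G$. For $S\subseteq V(G)$ let $K_S=\{I\in \mathrm{MIS}(G): S\subseteq I\}$, and write $K_v=K_{\{v\}}$. The convexity space $\mathcal{C}(G)$ is the family $\{K_S: S\subseteq V(G)\}$ of subsets of the ground set $X=\mathrm{MIS}(G)$ (equivalently, the closure of $\{K_v: v\in V(G)\}$ under taking intersections of subfamilies). A family of sets has the $(r,2)$-property if among any $r$ of its members there are two with nonempty intersection. A transversal of $\mathcal{G}$ is a set $T\subseteq X$ meeting every member of $\mathcal{G}$; $\tau(\mathcal{G})$ is the minimum size of a transversal. A bipartite induced matching of size $t$ in $G$ is a set of $2t$ distinct vertices $u_1,\dots,u_t,v_1,\dots,v_t$ such that $u_iv_j\in E(G)$ if and only if $i=j$; the bipartite induced matching number is the largest such $t$. An $n$-vertex graph $G$ is $\alpha$-ultra maximal $K_r$-free if it is $K_r$-free and for every pair of non-adjacent vertices $u,v$, the induced subgraph $G[N(u)\cap N(v)]$ contains at least $\alpha n^{r-2}$ copies of $K_{r-2}$. -}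

module Defs where

open import Data.Nat as ℕ using (ℕ; zero; suc; _^_; _∸_)
open import Data.Integer using (+_)
open import Data.Rational as ℚ using (ℚ; 0ℚ; _/_)
open import Data.Fin using (Fin)
open import Data.Fin.Properties using (all?; _≟_)
open import Data.Fin.Subset using (Subset; inside; outside; _∈_; _⊆_; _∩_; ∣_∣)
open import Data.Fin.Subset.Properties using (_∈?_; _⊆?_)
open import Data.Vec using ([]; _∷_; tabulate)
open import Data.List as List using (List; length; filter; _++_)
open import Data.List.Relation.Unary.All using (All)
open import Data.List.Relation.Unary.Any using (Any)
import Data.List.Membership.Propositional as List
open import Data.Product using (Σ; ∃₂; ∃-syntax; _×_; _,_)
open import Data.Sum using (_⊎_)
open import Function.Bundles using (_⇔_)
open import Function.Definitions using (Injective)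
open import Level using (0ℓ)
open import Relation.Binary using (Rel; Symmetric)
open import Relation.Binary.Definitions using (Decidable)
open import Relation.Binary.PropositionalEquality using (_≡_; _≢_)
open import Relation.Nullary using (Dec; ¬_; does)
open import Relation.Nullary.Decidable using (_×-dec_; _→-dec_; ¬?)
open import Relation.Unary as Pred using (Pred; Satisfiable; _≐_)

-- Dedekind reals: lower q means q < x, upper q means x < q.
record ℝ : Set₁ where
  field
    lower upper     : Pred ℚ 0ℓ
    lower-inhabited : Satisfiable lower
    upper-inhabited : Satisfiable upper
    lower-rounded   : ∀ p → lower p ⇔ (∃[ q ] p ℚ.< q × lower q)
    upper-rounded   : ∀ q → upper q ⇔ (∃[ p ] p ℚ.< q × upper p)
    disjoint        : ∀ q → ¬ (lower q × upper q)
    located         : ∀ p q → p ℚ.< q → lower p ⊎ upper q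

Positive : ℝ → Set
Positive x = ℝ.lower x 0ℚ

ℕ→ℚ : ℕ → ℚ
ℕ→ℚ m = + m / 1

-- The real inequality x · m ≤ k.  As x is the supremum of its lower cut and
-- m ≥ 0, it suffices to bound q · m for the rationals q < x.
_·_≤ᴿ_ : ℝ → ℕ → ℕ → Set
x · m ≤ᴿ k = ∀ q → ℝ.lower x q → q ℚ.* ℕ→ℚ m ℚ.≤ ℕ→ℚ k

-- Adjacency is decidable, as it always is classically.
record Graph (n : ℕ) : Set₁ where
  field
    _~_    : Rel (Fin n) 0ℓ
    _~?_   : Decidable _~_
    ~-sym  : Symmetric _~_
    ~-irrefl : ∀ v → ¬ (v ~ v)

module _ {n : ℕ} (G : Graph n) where
  open Graph G

  Independent : Pred (Subset n) 0ℓ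
  Independent S = ∀ x y → x ∈ S → y ∈ S → ¬ (x ~ y)

  MaximalIndependent : Pred (Subset n) 0ℓ
  MaximalIndependent I =
    Independent I × (∀ J → Independent J → I ⊆ J → J ⊆ I)

  MIS : Set
  MIS = Σ (Subset n) MaximalIndependent

  K : Subset n → Pred MIS 0ℓ
  K S (I , _) = S ⊆ I

  Convex : Pred (Pred MIS 0ℓ) 0ℓ
  Convex A = ∃[ S ] A ≐ K S

  record BipartiteInducedMatching (t : ℕ) : Set where
    field
      u v   : Fin t → Fin n
      u-inj : Injective _≡_ _≡_ u
      v-inj : Injective _≡_ _≡_ v
      u≢v   : ∀ i j → u i ≢ v j
      edge  : ∀ i j → (u i ~ v j) ⇔ (i ≡ j)

  BipartiteInducedMatchingNumber : ℕ → Set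
  BipartiteInducedMatchingNumber t =
    BipartiteInducedMatching t × (∀ s → BipartiteInducedMatching s → s ℕ.≤ t)

  IsClique : ℕ → Pred (Subset n) 0ℓ
  IsClique k S =
    ∣ S ∣ ≡ k × (∀ x y → x ∈ S → y ∈ S → x ≢ y → x ~ y)

  isClique? : ∀ k S → Dec (IsClique k S)
  isClique? k S =
    (∣ S ∣ ℕ.≟ k) ×-dec
    all? λ x → all? λ y →
      (x ∈? S) →-dec ((y ∈? S) →-dec (¬? (x ≟ y) →-dec (x ~? y)))

  CliqueFree : ℕ → Set
  CliqueFree k = ∀ S → ¬ IsClique k S

  N : Fin n → Subset n
  N u = tabulate λ v → does (u ~? v)

allSubsets : ∀ n → List (Subset n)
allSubsets zero    = List.[ [] ]
allSubsets (suc n) =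
  List.map (outside ∷_) (allSubsets n) ++ List.map (inside ∷_) (allSubsets n)

-- The number of (unlabelled) copies of K_k in the induced subgraph G[W].
cliqueCount : ∀ {n} → Graph n → Subset n → ℕ → ℕ
cliqueCount {n} G W k =
  length (filter (λ S → (S ⊆? W) ×-dec isClique? G k S) (allSubsets n))

UltraMaximalCliqueFree : ∀ {n} → ℝ → ℕ → Graph n → Set
UltraMaximalCliqueFree {n} α r G =
  CliqueFree G r ×
  (∀ u v → u ≢ v → ¬ (u ~ v) →
    α · (n ^ (r ∸ 2)) ≤ᴿ cliqueCount G (N G u ∩ N G v) (r ∸ 2))
  where open Graph G

-- A finite family of subsets of X is given by a list; order and repetitions
-- are immaterial below, since members are compared extensionally by ≐.
Family : Set → Set₁
Family X = List (Pred X 0ℓ)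

-- The (r,2)-property: among any r distinct members two intersect.
Property⟨_,2⟩ : ∀ {X} → ℕ → Family X → Set₁
Property⟨_,2⟩ {X} r 𝒢 =
  (A : Fin r → Pred X 0ℓ) →
  (∀ i → A i List.∈ 𝒢) →
  (∀ i j → i ≢ j → ¬ (A i ≐ A j)) →
  ∃₂ λ i j → i ≢ j × Satisfiable (A i Pred.∩ A j)

Transversal : ∀ {X} → Family X → List X → Set₁
Transversal 𝒢 T = All (λ A → Any A T) 𝒢

-- τ(𝒢) = k.  Transversals are listed, possibly with repetitions; these do not
-- affect the minimum.
TransversalNumber : ∀ {X} → Family X → ℕ → Set₁
TransversalNumber 𝒢 k =
  (∃[ T ] Transversal 𝒢 T × length T ≡ k) ×
  (∀ T → Transversal 𝒢 T → k ℕ.≤ length T)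

-- τ(𝒢) ≤ c, including the assertion that τ(𝒢) is finite.
τ_≤_ : ∀ {X} → Family X → ℕ → Set₁
τ 𝒢 ≤ c = ∃[ k ] TransversalNumber 𝒢 k × k ℕ.≤ c

-- The empty set is a member of C(G) as soon as G has an edge (it is K_S for any
-- S that is not independent), and a family containing it has no transversal, so
-- bounds on τ concern families of nonempty convex sets.
NonemptyMembers : ∀ {X} → Family X → Set₁
NonemptyMembers 𝒢 = All Satisfiable 𝒢

{-# OPTIONS --safe #-}

-- Members K_S and K_T are disjoint exactly when an edge of G joins S to T.
-- Under this relation the supports of a family with the (r,2)-property contain
-- no r pairwise related members, and an induced matching among them yields a
-- bipartite induced matching of G.  Such a graph is χ-bounded (Wagon): given an
-- edge ab, the vertices related to neither a nor b have a smaller induced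
-- matching number, and the neighbourhoods of a and of b have a smaller clique
-- number.  A colour class is a set of supports whose union is independent, so a
-- single maximal independent set meets all its members.
--
-- For the second part let k = r ∸ 2 and let (uᵢ, vᵢ) be a long bipartite induced
-- matching.  Fix i.  Averaging gives a k-clique W in N(uᵢ) lying in N(vⱼ) for a
-- constant proportion of the j.  As G has no K_r, some w ∈ W is not adjacent to
-- vᵢ; the many k-cliques in N(w) ∩ N(vᵢ) are, again by K_r-freeness, not
-- contained in N(vⱼ) for any surviving j.  Iterating on the surviving indices
-- yields pairwise disjoint collections of k-cliques, each of size at least
-- α n^k, hence at most 1/α of them.
module Submission where

open import Algebra.Properties.CommutativeSemigroup using (x∙yz≈y∙xz)
open import Data.Empty using (⊥-elim)
open import Data.Fin as Fin using (Fin; zero; suc)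
import Data.Fin.Properties as Fin
open import Data.Fin.Subset
  using (Subset; inside; outside; _∈_; _∉_; _⊆_; _⊂_; _∩_; _∪_; ⁅_⁆; ⋃; ∣_∣)
open import Data.Fin.Subset.Induction using (⊃-wellFounded; Acc; acc)
open import Data.Fin.Subset.Properties
  using (_∈?_; _⊆?_; _⊂?_; anySubset?; ∉⊥; p⊆p∪q; q⊆p∪q; x∈p∪q⁻; p∩q⊆p; p∩q⊆q;
         x∈p∩q⁺; x∈⁅y⁆⇒x≡y; ∪-identityˡ; drop-not-there)
import Data.Integer as ℤ
import Data.Integer.Properties as ℤ
open import Data.List as List using (List; []; _∷_; _++_; length; filter; lookup; map; allFin)
import Data.List.Membership.Propositional as L
open import Data.List.Membership.Propositional.Properties using (∈-filter⁺; ∈-filter⁻; ∈-lookup)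
import Data.List.Properties as List
open import Data.List.Relation.Unary.All as All using (All; []; _∷_)
import Data.List.Relation.Unary.All.Properties as All
open import Data.List.Relation.Unary.AllPairs using (AllPairs; []; _∷_)
open import Data.List.Relation.Unary.Any as Any using (Any; here; there)
import Data.List.Relation.Unary.Any.Properties as Any
open import Data.List.Relation.Unary.Unique.Propositional using (Unique)
import Data.List.Relation.Unary.Unique.Propositional.Properties as Unique
open import Data.Nat as ℕ using (ℕ; zero; suc; _+_; _*_; _^_; _≤_; _<_; z≤n; s≤s; _≤?_)
open import Data.Nat.ListAction using (sum)
open import Data.Nat.Properties
open import Data.Nat.Tactic.RingSolver using (solve-∀)
open import Data.Product using (_×_; _,_; proj₁; proj₂; ∃; ∃-syntax; ∃₂)
open import Data.Rational as ℚ using (0ℚ; mkℚ)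
import Data.Rational.Properties as ℚ
import Data.Rational.Unnormalised as ℚᵘ
import Data.Rational.Unnormalised.Properties as ℚᵘ
open import Data.Sum using (inj₁; inj₂)
import Data.Vec as Vec
open import Data.Vec.Properties using (lookup∘tabulate; lookup⇒[]=; []=⇒lookup)
open import Function using (_∘_; id)
open import Function.Bundles using (mk⇔; Equivalence)
open import Level using (Level; 0ℓ)
open import Relation.Binary as B using (Rel; Symmetric)
open import Relation.Binary.PropositionalEquality
open import Relation.Nullary using (Dec; yes; no; ¬_; contradiction)
open import Relation.Nullary.Decidable
  using (map′; _×-dec_; _→-dec_; ¬?; decidable-stable; dec-true)
open import Relation.Unary as Pred using (Pred; Decidable; Satisfiable; _≐_)
open import Defs

private variable
  a b p r : Level
  A B : Set a
  P Q R : Pred A p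

-- χ-boundedness of graphs without long induced matchings

-- One branch lowers the matching parameter and two lower the clique parameter; the leading `suc`
-- leaves room for the single class of the edgeless case.
colours : ℕ → ℕ → ℕ
colours zero    m       = 0
colours (suc r) zero    = 0
colours (suc r) (suc m) = suc (colours (suc r) m + (colours r (suc m) + colours r (suc m)))

module Colouring {X : Set} {_⌣_ : Rel X 0ℓ} (_⌣?_ : B.Decidable _⌣_) where

  -- Entries of `xs` may repeat, so a vertex related to itself yields cliques of every length, and
  -- loops call for no separate treatment.
  CliqueFreeOn : ℕ → List X → Set
  CliqueFreeOn r L = ∀ xs → All (L._∈ L) xs → AllPairs _⌣_ xs → length xs ≢ r

  Separated : Rel (X × X) 0ℓ
  Separated (a , b) (c , d) = (¬ a ⌣ c × ¬ b ⌣ c) × (¬ a ⌣ d × ¬ b ⌣ d)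

  InducedMatchingFree : ℕ → List X → Set
  InducedMatchingFree m L =
    ∀ es → All (λ (a , b) → (a L.∈ L × b L.∈ L) × a ⌣ b) es → AllPairs Separated es →
    length es ≢ m

  Stable : Pred (List X) 0ℓ
  Stable P = ∀ {x y} → x L.∈ P → y L.∈ P → ¬ x ⌣ y

  Colourable : ℕ → List X → Set
  Colourable c L =
    ∃[ Ps ] length Ps ≤ c × All Stable Ps × (∀ {x} → x L.∈ L → Any (x L.∈_) Ps)

  Isolated? : ∀ a b → Decidable (λ x → ¬ a ⌣ x × ¬ b ⌣ x)
  Isolated? a b x = ¬? (a ⌣? x) ×-dec ¬? (b ⌣? x)

  neighbours-cliqueFree : ∀ {r a L} → a L.∈ L → CliqueFreeOn (suc r) L →
    CliqueFreeOn r (filter (a ⌣?_) L)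
  neighbours-cliqueFree {a = a} {L} a∈L free xs xs⊆ pairs len =
    free (a ∷ xs)
      (a∈L ∷ All.map (proj₁ ∘ ∈-filter⁻ (a ⌣?_)) xs⊆)
      (All.map (proj₂ ∘ ∈-filter⁻ (a ⌣?_) {xs = L}) xs⊆ ∷ pairs)
      (cong suc len)

  filter-cliqueFree : ∀ {r L} {P : Pred X p} (P? : Decidable P) →
    CliqueFreeOn r L → CliqueFreeOn r (filter P? L)
  filter-cliqueFree P? free xs = free xs ∘ All.map (proj₁ ∘ ∈-filter⁻ P?)

  filter-matchingFree : ∀ {m L} {P : Pred X p} (P? : Decidable P) →
    InducedMatchingFree m L → InducedMatchingFree m (filter P? L)
  filter-matchingFree P? free es = free es ∘ All.map
    λ ((a∈ , b∈) , a⌣b) → (proj₁ (∈-filter⁻ P? a∈) , proj₁ (∈-filter⁻ P? b∈)) , a⌣b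

  isolated-matchingFree : ∀ {m a b L} → a L.∈ L → b L.∈ L → a ⌣ b →
    InducedMatchingFree (suc m) L → InducedMatchingFree m (filter (Isolated? a b) L)
  isolated-matchingFree {a = a} {b} {L} a∈L b∈L a⌣b free es es⊆ pairs len =
    free ((a , b) ∷ es)
      (((a∈L , b∈L) , a⌣b) ∷ All.map
        (λ ((c∈ , d∈) , c⌣d) → (proj₁ (∈-filter⁻ I? c∈) , proj₁ (∈-filter⁻ I? d∈)) , c⌣d) es⊆)
      (All.map
        (λ ((c∈ , d∈) , _) → proj₂ (∈-filter⁻ I? {xs = L} c∈) , proj₂ (∈-filter⁻ I? {xs = L} d∈))
        es⊆ ∷ pairs)
      (cong suc len)
    where I? = Isolated? a b

  -- Wagon's recursion at an edge ab. The three sublists may overlap: the classes are simply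
  -- concatenated, and `cover` finds one class for each vertex.
  colourable : ∀ r m L → CliqueFreeOn r L → InducedMatchingFree m L →
    Colourable (colours r m) L
  -- The empty list is a clique of size 0, and below an induced matching of size 0.
  colourable zero    m       L cf mf = contradiction refl (cf [] [] [])
  colourable (suc r) zero    L cf mf = contradiction refl (mf [] [] [])
  colourable (suc r) (suc m) L cf mf with Any.any? (λ x → Any.any? (x ⌣?_) L) L
  ... | no no-edge = L ∷ [] , s≤s z≤n , stable ∷ [] , here
    where
    stable : Stable L
    stable x∈ y∈ x⌣y = no-edge (L.lose x∈ (L.lose y∈ x⌣y))
  ... | yes some-edge
    with a , a∈L , a-edge ← L.find some-edge
    with b , b∈L , a⌣b ← L.find a-edge
    with Ps , Ps≤ , Ps-stable , Ps-cover ←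
           colourable (suc r) m (filter (Isolated? a b) L)
             (filter-cliqueFree _ cf) (isolated-matchingFree a∈L b∈L a⌣b mf)
       | Qs , Qs≤ , Qs-stable , Qs-cover ←
           colourable r (suc m) (filter (a ⌣?_) L)
             (neighbours-cliqueFree a∈L cf) (filter-matchingFree _ mf)
       | Rs , Rs≤ , Rs-stable , Rs-cover ←
           colourable r (suc m) (filter (b ⌣?_) L)
             (neighbours-cliqueFree b∈L cf) (filter-matchingFree _ mf)
    = Ps ++ Qs ++ Rs
    , m≤n⇒m≤1+n (≤-trans
        (≤-reflexive (trans (List.length-++ Ps) (cong (length Ps +_) (List.length-++ Qs))))
        (+-mono-≤ Ps≤ (+-mono-≤ Qs≤ Rs≤)))
    , All.++⁺ Ps-stable (All.++⁺ Qs-stable Rs-stable)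
    , cover
    where
    cover : ∀ {x} → x L.∈ L → Any (x L.∈_) (Ps ++ Qs ++ Rs)
    cover {x} x∈L with a ⌣? x | b ⌣? x
    ... | yes a⌣x | _       = Any.++⁺ʳ Ps (Any.++⁺ˡ (Qs-cover (∈-filter⁺ (a ⌣?_) x∈L a⌣x)))
    ... | no  _   | yes b⌣x = Any.++⁺ʳ Ps (Any.++⁺ʳ Qs (Rs-cover (∈-filter⁺ (b ⌣?_) x∈L b⌣x)))
    ... | no a⌣̸x  | no b⌣̸x  = Any.++⁺ˡ (Ps-cover (∈-filter⁺ (Isolated? a b) x∈L (a⌣̸x , b⌣̸x)))

-- Transversals by maximal independent sets

AllPairs-lookup : ∀ {R : Rel A b} → Symmetric R → ∀ {xs} → AllPairs R xs →
  ∀ i j → i ≢ j → R (lookup xs i) (lookup xs j)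
AllPairs-lookup R-sym (_  ∷ _)  zero    zero    i≢j = contradiction refl i≢j
AllPairs-lookup R-sym (px ∷ _)  zero    (suc j) i≢j = All.lookup px (∈-lookup j)
AllPairs-lookup R-sym (px ∷ _)  (suc i) zero    i≢j = R-sym (All.lookup px (∈-lookup i))
AllPairs-lookup R-sym (_  ∷ ps) (suc i) (suc j) i≢j = AllPairs-lookup R-sym ps i j (i≢j ∘ cong suc)

-- Turns an upper bound into the exact minimum that `TransversalNumber` asks for.
least : ∀ {P : Pred ℕ p} → Decidable P → ∀ m → P m → ∃[ k ] P k × (∀ j → P j → k ≤ j) × k ≤ m
least P? m pm with P? 0
... | yes p0 = 0 , p0 , (λ _ _ → z≤n) , z≤n
least P? zero    pm | no ¬p0 = contradiction pm ¬p0
least {P = P} P? (suc m) pm | no ¬p0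
  with k , pk , minimal , k≤m ← least (P? ∘ suc) m pm = suc k , pk , minimal′ , s≤s k≤m
  where
  minimal′ : ∀ j → P j → suc k ≤ j
  minimal′ zero    p0 = contradiction p0 ¬p0
  minimal′ (suc j) pj = s≤s (minimal j pj)

⊆⋃ : ∀ {n} {S : Subset n} {Ss} → S L.∈ Ss → S ⊆ ⋃ Ss
⊆⋃ (here refl)          = p⊆p∪q _
⊆⋃ {Ss = T ∷ _} (there S∈Ss) = q⊆p∪q T _ ∘ ⊆⋃ S∈Ss

∈⋃⁻ : ∀ {n} {x : Fin n} Ss → x ∈ ⋃ Ss → ∃[ S ] S L.∈ Ss × x ∈ S
∈⋃⁻ []       x∈ = contradiction x∈ ∉⊥
∈⋃⁻ (S ∷ Ss) x∈ with x∈p∪q⁻ S (⋃ Ss) x∈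
... | inj₁ x∈S = S , here refl , x∈S
... | inj₂ x∈⋃ with T , T∈ , x∈T ← ∈⋃⁻ Ss x∈⋃ = T , there T∈ , x∈T

module Transversals {n : ℕ} (G : Graph n) where
  open Graph G

  _⌣_ : Rel (Subset n) 0ℓ
  S ⌣ T = ∃₂ λ x y → (x ∈ S × y ∈ T) × x ~ y

  _⌣?_ : B.Decidable _⌣_
  S ⌣? T = Fin.any? λ x → Fin.any? λ y → (x ∈? S ×-dec y ∈? T) ×-dec (x ~? y)

  ⌣-sym : Symmetric _⌣_
  ⌣-sym (x , y , (x∈ , y∈) , x~y) = y , x , (y∈ , x∈) , ~-sym x~y

  open Colouring _⌣?_

  independent? : Decidable (Independent G)
  independent? S = Fin.all? λ x → Fin.all? λ y → x ∈? S →-dec (y ∈? S →-dec ¬? (x ~? y))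

  Extension : Subset n → Pred (Subset n) 0ℓ
  Extension I J = Independent G J × I ⊂ J

  extension? : ∀ I → Decidable (Extension I)
  extension? I J = independent? J ×-dec (I ⊂? J)

  maximal : ∀ {I} → Independent G I → ¬ ∃ (Extension I) → MaximalIndependent G I
  maximal {I} indep none = indep , λ J J-indep I⊆J {x} x∈J →
    decidable-stable (x ∈? I) λ x∉I → none (J , J-indep , I⊆J , x , x∈J , x∉I)

  maximalIndependent? : Decidable (MaximalIndependent G)
  maximalIndependent? I = map′
    (λ (indep , none) → maximal indep none)
    (λ (indep , max) → indep , λ (J , J-indep , I⊆J , x , x∈J , x∉I) → x∉I (max J J-indep I⊆J x∈J))
    (independent? I ×-dec ¬? (anySubset? (extension? I)))

  extend : ∀ I → Acc (λ S T → T ⊂ S) I → Independent G I → ∃[ J ] MaximalIndependent G J × I ⊆ J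
  extend I (acc rec) indep with anySubset? (extension? I)
  ... | no none = I , maximal indep none , id
  ... | yes (J , J-indep , I⊂J) with M , M-max , J⊆M ← extend J (rec I⊂J) J-indep
      = M , M-max , J⊆M ∘ proj₁ I⊂J

  stable⇒independent : ∀ {P} → Stable P → Independent G (⋃ P)
  stable⇒independent {P} stable x y x∈ y∈ x~y
    with S , S∈P , x∈S ← ∈⋃⁻ P x∈ | T , T∈P , y∈T ← ∈⋃⁻ P y∈
    = stable S∈P T∈P (x , y , (x∈S , y∈T) , x~y)

  Covers : List (Subset n) → List (MIS G) → Set
  Covers Ss T = All (λ S → Any (K G S) T) Ss

  classes⇒MIS : ∀ {Ps} → All Stable Ps →
    ∃[ T ] length T ≡ length Ps × (∀ {S} → Any (S L.∈_) Ps → Any (K G S) T)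
  classes⇒MIS []             = [] , refl , λ ()
  classes⇒MIS {P ∷ _} (stable ∷ stables)
    with T , len , cover ← classes⇒MIS stables
       | M , M-max , ⋃P⊆M ← extend (⋃ P) (⊃-wellFounded _) (stable⇒independent {P} stable)
    = (M , M-max) ∷ T , cong suc len , λ where
        (here S∈P)  → here (⋃P⊆M ∘ ⊆⋃ S∈P)
        (there S∈) → there (cover S∈)

  missed? : ∀ I → Decidable (λ (S : Subset n) → ¬ S ⊆ I)
  missed? I S = ¬? (S ⊆? I)

  -- Branch over all subsets for the first set I; the other k - 1 sets then have to cover just the
  -- supports that I misses.
  covers? : ∀ k Ss → Dec (∃[ T ] Covers Ss T × length T ≡ k)
  covers? zero    []       = yes ([] , [] , refl)
  covers? zero    (_ ∷ _)  = no λ { ([] , () ∷ _ , _) }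
  covers? (suc k) Ss = map′ to from
    (anySubset? λ I → maximalIndependent? I ×-dec covers? k (filter (missed? I) Ss))
    where
    to : (∃[ I ] MaximalIndependent G I × ∃[ T ] Covers (filter (missed? I) Ss) T × length T ≡ k) →
         ∃[ T ] Covers Ss T × length T ≡ suc k
    to (I , I-max , T , covers , len) = (I , I-max) ∷ T , All.tabulate cover , cong suc len
      where
      cover : ∀ {S} → S L.∈ Ss → Any (K G S) ((I , I-max) ∷ T)
      cover {S} S∈ with S ⊆? I
      ... | yes S⊆I = here S⊆I
      ... | no  S⊈I = there (All.lookup covers (∈-filter⁺ (missed? I) S∈ S⊈I))
    from : ∃[ T ] Covers Ss T × length T ≡ suc k →
      ∃[ I ] MaximalIndependent G I × ∃[ T ] Covers (filter (missed? I) Ss) T × length T ≡ k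
    from ((I , I-max) ∷ T , covers , len) = I , I-max , T , All.tabulate cover , suc-injective len
      where
      cover : ∀ {S} → S L.∈ filter (missed? I) Ss → Any (K G S) T
      cover S∈ with ∈-filter⁻ (missed? I) S∈
      ... | S∈Ss , S⊈I with All.lookup covers S∈Ss
      ... | here S⊆I = ⊥-elim (S⊈I S⊆I)
      ... | there any = any

  -- Both directions matter: a support coming from a member transfers the (r,2)-property and the
  -- minimality of τ, and a member having a support turns a cover into a transversal.
  supports : ∀ {𝒢} → All (Convex G) 𝒢 →
    ∃[ Ss ] All (λ S → Any (_≐ K G S) 𝒢) Ss × All (λ A → Any (λ S → A ≐ K G S) Ss) 𝒢
  supports [] = [] , [] , []
  supports ((S , A≐) ∷ convex) with Ss , back , forth ← supports convex
    = S ∷ Ss , here A≐ ∷ All.map there back , here A≐ ∷ All.map there forth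

  module _ {𝒢 : Family (MIS G)} (nonempty : NonemptyMembers 𝒢) where

    disjoint : ∀ {A B : Pred (MIS G) 0ℓ} {S T} →
      A ≐ K G S → B ≐ K G T → S ⌣ T → ¬ Satisfiable (A Pred.∩ B)
    disjoint A≐ B≐ (x , y , (x∈S , y∈T) , x~y) (I , I∈A , I∈B) =
      proj₁ (proj₂ I) x y (proj₁ A≐ I∈A x∈S) (proj₁ B≐ I∈B y∈T) x~y

    -- Pairwise related supports belong to pairwise disjoint members. Being nonempty, these are also
    -- pairwise distinct, as the (r,2)-property requires of its input.
    supports-cliqueFree : ∀ {r Ss} → All (λ S → Any (_≐ K G S) 𝒢) Ss → Property⟨ r ,2⟩ 𝒢 →
      CliqueFreeOn r Ss
    supports-cliqueFree back property xs xs⊆ pairs refl =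
      let i , j , i≢j , meet = property M M∈ distinct in apart i j i≢j meet
      where
      member : ∀ i → ∃[ A ] A L.∈ 𝒢 × A ≐ K G (lookup xs i)
      member i = L.find (All.lookup back (All.lookup xs⊆ (∈-lookup i)))
      M  = proj₁ ∘ member
      M∈ = proj₁ ∘ proj₂ ∘ member
      apart : ∀ i j → i ≢ j → ¬ Satisfiable (M i Pred.∩ M j)
      apart i j i≢j = disjoint (proj₂ (proj₂ (member i))) (proj₂ (proj₂ (member j)))
        (AllPairs-lookup ⌣-sym pairs i j i≢j)
      distinct : ∀ i j → i ≢ j → ¬ (M i ≐ M j)
      distinct i j i≢j Mᵢ≐Mⱼ with I , I∈Mᵢ ← All.lookup nonempty (M∈ i)
        = apart i j i≢j (I , I∈Mᵢ , proj₁ Mᵢ≐Mⱼ I∈Mᵢ)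

  Separated-sym : Symmetric Separated
  Separated-sym ((ac , bc) , (ad , bd)) = (ac ∘ ⌣-sym , ad ∘ ⌣-sym) , (bc ∘ ⌣-sym , bd ∘ ⌣-sym)

  -- Each related pair (Sᵢ, Tᵢ) provides adjacent witnesses uᵢ in Sᵢ and vᵢ in Tᵢ. An edge from uᵢ
  -- to vⱼ with i ≠ j would relate Sᵢ to Tⱼ; injectivity follows from this as well.
  inducedMatching⇒bipartite : ∀ es → All (λ (S , T) → S ⌣ T) es → AllPairs Separated es →
    BipartiteInducedMatching G (length es)
  inducedMatching⇒bipartite es edges pairs = record
    { u = u ; v = v
    ; u-inj = λ {i} {j} uᵢ≡uⱼ → edge⇒≡ i j (subst (_~ v j) (sym uᵢ≡uⱼ) (u~v j))
    ; v-inj = λ {i} {j} vᵢ≡vⱼ → edge⇒≡ i j (subst (u i ~_) vᵢ≡vⱼ (u~v i))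
    ; u≢v = u≢v
    ; edge = λ i j → mk⇔ (edge⇒≡ i j) λ { refl → u~v i }
    }
    where
    edgeOf : ∀ i → proj₁ (lookup es i) ⌣ proj₂ (lookup es i)
    edgeOf i = All.lookup edges (∈-lookup i)
    u v : Fin (length es) → Fin n
    u i = proj₁ (edgeOf i)
    v i = proj₁ (proj₂ (edgeOf i))
    u∈ : ∀ i → u i ∈ proj₁ (lookup es i)
    u∈ i = proj₁ (proj₁ (proj₂ (proj₂ (edgeOf i))))
    v∈ : ∀ i → v i ∈ proj₂ (lookup es i)
    v∈ i = proj₂ (proj₁ (proj₂ (proj₂ (edgeOf i))))
    u~v : ∀ i → u i ~ v i
    u~v i = proj₂ (proj₂ (proj₂ (edgeOf i)))
    separated : ∀ i j → i ≢ j → Separated (lookup es i) (lookup es j)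
    separated = AllPairs-lookup Separated-sym pairs
    edge⇒≡ : ∀ i j → u i ~ v j → i ≡ j
    edge⇒≡ i j uᵢ~vⱼ = decidable-stable (i Fin.≟ j) λ i≢j →
      proj₁ (proj₂ (separated i j i≢j)) (u i , v j , (u∈ i , v∈ j) , uᵢ~vⱼ)
    u≢v : ∀ i j → u i ≢ v j
    u≢v i j uᵢ≡vⱼ with i Fin.≟ j
    ... | yes refl = ~-irrefl (v i) (subst (_~ v i) uᵢ≡vⱼ (u~v i))
    -- Here uⱼ is adjacent to vⱼ = uᵢ, which would relate Sᵢ to Sⱼ.
    ... | no i≢j = proj₁ (proj₁ (separated i j i≢j))
      (u i , u j , (u∈ i , u∈ j) , ~-sym (subst (u j ~_) (sym uᵢ≡vⱼ) (u~v j)))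

  τ-bound : ∀ {r t} → (∀ s → BipartiteInducedMatching G s → s ≤ t) →
    ∀ 𝒢 → All (Convex G) 𝒢 → NonemptyMembers 𝒢 → Property⟨ r ,2⟩ 𝒢 →
    τ 𝒢 ≤ colours r (suc t)
  τ-bound {r} {t} bound 𝒢 convex nonempty property
    with Ss , back , forth ← supports convex
    with Ps , Ps≤ , Ps-stable , Ps-cover ←
      colourable r (suc t) Ss (supports-cliqueFree nonempty back property)
        -- Matchings have size at most t, so size `suc t` is the first one excluded.
        (λ es es⊆ pairs len → 1+n≰n (subst (_≤ t) len
          (bound _ (inducedMatching⇒bipartite es (All.map proj₂ es⊆) pairs))))
    with T , len , T-cover ← classes⇒MIS Ps-stable
    -- The colour classes give one cover, whose length bounds the search for the minimum.
    with k , (T′ , covers , len′) , minimal , k≤ ←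
      least (λ k → covers? k Ss) (length T) (T , All.tabulate (T-cover ∘ Ps-cover) , refl)
    = k , ((T′ , All.map (transversal covers) forth , len′) , minimum)
        , ≤-trans k≤ (≤-trans (≤-reflexive len) Ps≤)
    where
    transversal : ∀ {T} → Covers Ss T → ∀ {A} → Any (λ S → A ≐ K G S) Ss → Any A T
    transversal covers any with S , S∈ , A≐ ← L.find any
      = Any.map (proj₂ A≐) (All.lookup covers S∈)
    minimum : ∀ T → Transversal 𝒢 T → k ≤ length T
    minimum T trans = minimal (length T) (T , All.map cover back , refl)
      where
      cover : ∀ {S} → Any (_≐ K G S) 𝒢 → Any (K G S) T
      cover any with A , A∈ , A≐ ← L.find any = Any.map (proj₁ A≐) (All.lookup trans A∈)

-- Ultra maximal clique-free graphs

count-disjoint : (P? : Decidable P) (Q? : Decidable Q) (R? : Decidable R) →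
  (∀ {x} → P x → R x) → (∀ {x} → Q x → R x) → (∀ {x} → P x → ¬ Q x) →
  ∀ xs → length (filter P? xs) + length (filter Q? xs) ≤ length (filter R? xs)
count-disjoint P? Q? R? P⊆R Q⊆R disj [] = z≤n
count-disjoint P? Q? R? P⊆R Q⊆R disj (x ∷ xs)
  with P? x | Q? x | R? x | count-disjoint P? Q? R? P⊆R Q⊆R disj xs
... | yes px | yes qx | _      | _  = contradiction qx (disj px)
... | yes px | no  _  | no ¬rx | _  = contradiction (P⊆R px) ¬rx
... | no  _  | yes qx | no ¬rx | _  = contradiction (Q⊆R qx) ¬rx
... | yes _  | no  _  | yes _  | ih = s≤s ih
... | no  _  | yes _  | yes _  | ih = ≤-trans (≤-reflexive (+-suc _ _)) (s≤s ih)
... | no  _  | no  _  | yes _  | ih = m≤n⇒m≤1+n ih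
... | no  _  | no  _  | no  _  | ih = ih

count-mono : (P? : Decidable P) (Q? : Decidable Q) → (∀ {x} → P x → Q x) →
  ∀ xs → length (filter P? xs) ≤ length (filter Q? xs)
count-mono P? Q? P⊆Q xs = ≤-trans (m≤m+n _ _)
  (count-disjoint P? (λ x → Q? x ×-dec ¬? (P? x)) Q? P⊆Q proj₁ (λ px (_ , ¬px) → ¬px px) xs)

count-filter : (P? : Decidable P) (Q? : Decidable Q) (R? : Decidable R) →
  (∀ {x} → P x → Q x) → (∀ {x} → P x → R x) →
  ∀ xs → length (filter P? xs) ≤ length (filter R? (filter Q? xs))
count-filter P? Q? R? P⊆Q P⊆R [] = z≤n
count-filter P? Q? R? P⊆Q P⊆R (x ∷ xs) with P? x | Q? x | count-filter P? Q? R? P⊆Q P⊆R xs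
... | no  _  | no  _  | ih = ih
... | yes px | no ¬qx | _  = contradiction (P⊆Q px) ¬qx
... | p?     | yes _  | ih with p? | R? x
... | yes _  | yes _  = s≤s ih
... | yes px | no ¬rx = contradiction (P⊆R px) ¬rx
... | no  _  | yes _  = m≤n⇒m≤1+n ih
... | no  _  | no  _  = ih

count-map : (P? : Decidable P) (f : A → B) →
  ∀ xs → length (filter P? (map f xs)) ≡ length (filter (P? ∘ f) xs)
count-map P? f [] = refl
count-map P? f (x ∷ xs) with P? (f x)
... | yes _ = cong suc (count-map P? f xs)
... | no  _ = count-map P? f xs

-- Double counting

module Averaging {R : A → B → Set r} (R? : ∀ x y → Dec (R x y)) (d : ℕ) where

  degree : List B → A → ℕ
  degree ys x = length (filter (R? x) ys)

  codegree : List A → B → ℕ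
  codegree xs y = length (filter (λ x → R? x y) xs)

  incidences : List A → List B → ℕ
  incidences xs ys = sum (map (degree ys) xs)

  incidences-∷ : ∀ xs y ys → incidences xs (y ∷ ys) ≡ codegree xs y + incidences xs ys
  incidences-∷ []       y ys = refl
  incidences-∷ (x ∷ xs) y ys
    with R? x y
       | trans (cong (degree ys x +_) (incidences-∷ xs y ys))
           (x∙yz≈y∙xz +-commutativeSemigroup (degree ys x) (codegree xs y) _)
  ... | yes _ | exchange = cong suc exchange
  ... | no  _ | exchange = exchange

  incidences-lower : ∀ {N} xs ys → (∀ {x} → x L.∈ xs → N ≤ d * degree ys x) →
    length xs * N ≤ d * incidences xs ys
  incidences-lower []       ys large = z≤n
  incidences-lower (x ∷ xs) ys large =
    ≤-trans (+-mono-≤ (large (here refl)) (incidences-lower xs ys (large ∘ there)))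
            (≤-reflexive (sym (*-distribˡ-+ d (degree ys x) _)))

  -- Each strict inequality saves one unit; the savings are collected in the summand `length ys`.
  incidences-upper : ∀ xs ys → All (λ y → d * codegree xs y < length xs) ys →
    d * incidences xs ys + length ys ≤ length ys * length xs
  incidences-upper xs [] [] = ≤-reflexive (trans (+-identityʳ _) (trans (cong (d *_) (empty xs)) (*-zeroʳ d)))
    where
    empty : ∀ xs → incidences xs [] ≡ 0
    empty []       = refl
    empty (_ ∷ xs) = empty xs
  incidences-upper xs (y ∷ ys) (small ∷ smalls) = begin
    d * incidences xs (y ∷ ys) + suc (length ys)
      ≡⟨ cong (λ s → d * s + suc (length ys)) (incidences-∷ xs y ys) ⟩
    d * (codegree xs y + incidences xs ys) + suc (length ys)
      ≡⟨ regroup d (codegree xs y) (incidences xs ys) (length ys) ⟩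
    suc (d * codegree xs y) + (d * incidences xs ys + length ys)
      ≤⟨ +-mono-≤ small (incidences-upper xs ys smalls) ⟩
    length xs + length ys * length xs ∎
    where
    open ≤-Reasoning
    regroup : ∀ d a b c → d * (a + b) + suc c ≡ suc (d * a) + (d * b + c)
    regroup = solve-∀

  -- If no y were popular, d times the number of incidences would be at least `length xs * N` and,
  -- with `length ys` to spare, at most `length ys * length xs`. As `length ys ≤ N`, this forces
  -- `ys` to be empty, and then `length xs * N` vanishes.
  popular : ∀ {N} xs ys → 0 < N → length ys ≤ N → 0 < length xs →
    (∀ {x} → x L.∈ xs → N ≤ d * degree ys x) →
    ∃[ y ] y L.∈ ys × length xs ≤ d * codegree xs y
  popular {N} xs ys 0<N ys≤N 0<xs large with Any.any? (λ y → length xs ≤? d * codegree xs y) ys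
  ... | yes some = L.find some
  ... | no none = contradiction (*-mono-≤ 0<xs 0<N) (<⇒≱ (s≤s nil))
    where
    open ≤-Reasoning
    upper = incidences-upper xs ys (All.map ≰⇒> (All.¬Any⇒All¬ ys none))
    excess : d * incidences xs ys + length ys ≤ d * incidences xs ys + 0
    excess = begin
      d * incidences xs ys + length ys ≤⟨ upper ⟩
      length ys * length xs            ≤⟨ *-monoˡ-≤ (length xs) ys≤N ⟩
      N * length xs                    ≡⟨ *-comm N (length xs) ⟩
      length xs * N                    ≤⟨ incidences-lower xs ys large ⟩
      d * incidences xs ys             ≡⟨ +-identityʳ _ ⟨
      d * incidences xs ys + 0         ∎
    no-ys : length ys ≡ 0
    no-ys = n≤0⇒n≡0 (+-cancelˡ-≤ (d * incidences xs ys) _ _ excess)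
    nil : length xs * N ≤ 0
    nil = begin
      length xs * N                    ≤⟨ incidences-lower xs ys large ⟩
      d * incidences xs ys             ≤⟨ m≤m+n _ _ ⟩
      d * incidences xs ys + length ys ≤⟨ upper ⟩
      length ys * length xs            ≡⟨ cong (_* length xs) no-ys ⟩
      0                                ∎

-- Pascal's recursion on the first element. The crude bound n^k is used twice: for the candidate
-- cliques in the averaging and for the total space of the packing.
count-ofSize : ∀ n k → length (filter (λ S → ∣ S ∣ ℕ.≟ k) (allSubsets n)) ≤ n ^ k
count-ofSize zero    zero    = ≤-refl
count-ofSize zero    (suc k) = z≤n
count-ofSize (suc n) k = begin
  length (filter ofSize? (map (outside Vec.∷_) Ss ++ map (inside Vec.∷_) Ss))
    ≡⟨ cong length (List.filter-++ ofSize? (map (outside Vec.∷_) Ss) _) ⟩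
  length (filter ofSize? (map (outside Vec.∷_) Ss) ++ filter ofSize? (map (inside Vec.∷_) Ss))
    ≡⟨ List.length-++ (filter ofSize? (map (outside Vec.∷_) Ss)) ⟩
  length (filter ofSize? (map (outside Vec.∷_) Ss)) + length (filter ofSize? (map (inside Vec.∷_) Ss))
    ≡⟨ cong₂ _+_ (count-map ofSize? (outside Vec.∷_) Ss) (count-map ofSize? (inside Vec.∷_) Ss) ⟩
  length (filter (λ S → ∣ S ∣ ℕ.≟ k) Ss) + length (filter (λ S → suc ∣ S ∣ ℕ.≟ k) Ss)
    ≤⟨ +-mono-≤ (count-ofSize n k) ≤-refl ⟩
  n ^ k + length (filter (λ S → suc ∣ S ∣ ℕ.≟ k) Ss)
    ≤⟨ with-zero k ⟩
  suc n ^ k ∎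
  where
  open ≤-Reasoning
  Ss = allSubsets n
  ofSize? : Decidable (λ S → ∣ S ∣ ≡ k)
  ofSize? S = ∣ S ∣ ℕ.≟ k
  with-zero : ∀ k → n ^ k + length (filter (λ S → suc ∣ S ∣ ℕ.≟ k) Ss) ≤ suc n ^ k
  with-zero zero = ≤-reflexive (cong suc (cong length
    (List.filter-none (λ S → suc ∣ S ∣ ℕ.≟ 0) (All.universal (λ _ ()) Ss))))
  with-zero (suc k) = begin
    n * n ^ k + length (filter (λ S → suc ∣ S ∣ ℕ.≟ suc k) Ss)
      ≤⟨ +-mono-≤ (*-monoʳ-≤ n (^-monoˡ-≤ k (n≤1+n n)))
           (≤-trans (count-mono _ (λ S → ∣ S ∣ ℕ.≟ k) suc-injective Ss) (count-ofSize n k)) ⟩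
    n * suc n ^ k + n ^ k
      ≤⟨ +-monoʳ-≤ (n * suc n ^ k) (^-monoˡ-≤ k (n≤1+n n)) ⟩
    n * suc n ^ k + suc n ^ k
      ≡⟨ +-comm _ (suc n ^ k) ⟩
    suc n ^ suc k ∎

-- Packing cliques along a bipartite induced matching

∣⁅x⁆∪S∣ : ∀ {n} {x : Fin n} {S} → x ∉ S → ∣ ⁅ x ⁆ ∪ S ∣ ≡ suc ∣ S ∣
∣⁅x⁆∪S∣ {x = zero}  {inside  Vec.∷ S} x∉S = contradiction Vec.here x∉S
∣⁅x⁆∪S∣ {x = zero}  {outside Vec.∷ S} x∉S = cong (suc ∘ ∣_∣) (∪-identityˡ S)
∣⁅x⁆∪S∣ {x = suc x} {inside  Vec.∷ S} x∉S = cong suc (∣⁅x⁆∪S∣ (drop-not-there x∉S))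
∣⁅x⁆∪S∣ {x = suc x} {outside Vec.∷ S} x∉S = ∣⁅x⁆∪S∣ (drop-not-there x∉S)

-- Indices that suffice for s rounds of `packing`: one is spent as i, one more keeps the remainder
-- nonempty, and at least a 1/d share of the remainder survives.
threshold : ℕ → ℕ → ℕ
threshold d zero    = 0
threshold d (suc s) = 2 + d * threshold d s

module Cliques {n : ℕ} (G : Graph n) where
  open Graph G

  ∈N⁺ : ∀ {x y} → x ~ y → y ∈ N G x
  ∈N⁺ {x} {y} x~y = lookup⇒[]= y _ (trans (lookup∘tabulate _ y) (dec-true (x ~? y) x~y))

  ∈N⁻ : ∀ {x y} → y ∈ N G x → x ~ y
  ∈N⁻ {x} {y} y∈ with x ~? y | trans (sym (lookup∘tabulate _ y)) ([]=⇒lookup y∈)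
  ... | yes x~y | _ = x~y
  ... | no  _   | ()

  insert-clique : ∀ {k x S} → IsClique G k S → (∀ {y} → y ∈ S → x ~ y) →
    IsClique G (suc k) (⁅ x ⁆ ∪ S)
  insert-clique {x = x} {S} (size , adjacent) x~S =
    trans (∣⁅x⁆∪S∣ (~-irrefl x ∘ x~S)) (cong suc size) , adjacent′
    where
    adjacent′ : ∀ y z → y ∈ ⁅ x ⁆ ∪ S → z ∈ ⁅ x ⁆ ∪ S → y ≢ z → y ~ z
    adjacent′ y z y∈ z∈ y≢z with x∈p∪q⁻ ⁅ x ⁆ S y∈ | x∈p∪q⁻ ⁅ x ⁆ S z∈
    ... | inj₂ y∈S | inj₂ z∈S = adjacent y z y∈S z∈S y≢z
    ... | inj₁ y∈x | inj₂ z∈S rewrite x∈⁅y⁆⇒x≡y x y∈x = x~S z∈S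
    ... | inj₂ y∈S | inj₁ z∈x rewrite x∈⁅y⁆⇒x≡y x z∈x = ~-sym (x~S y∈S)
    ... | inj₁ y∈x | inj₁ z∈x = contradiction (trans (x∈⁅y⁆⇒x≡y x y∈x) (sym (x∈⁅y⁆⇒x≡y x z∈x))) y≢z

  -- The source of every forbidden clique below: an edge joined completely to a k-clique.
  insert-edge : ∀ {k x y S} → IsClique G k S → x ~ y →
    (∀ {z} → z ∈ S → x ~ z) → (∀ {z} → z ∈ S → y ~ z) →
    IsClique G (2 + k) (⁅ x ⁆ ∪ (⁅ y ⁆ ∪ S))
  insert-edge {x = x} {y} {S} clique x~y x~S y~S = insert-clique (insert-clique clique y~S) x~yS
    where
    x~yS : ∀ {z} → z ∈ ⁅ y ⁆ ∪ S → x ~ z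
    x~yS z∈ with x∈p∪q⁻ ⁅ y ⁆ S z∈
    ... | inj₁ z∈y rewrite x∈⁅y⁆⇒x≡y y z∈y = x~y
    ... | inj₂ z∈S = x~S z∈S

  CliqueIn : ℕ → Subset n → Pred (Subset n) 0ℓ
  CliqueIn k W S = S ⊆ W × IsClique G k S

  cliqueIn? : ∀ k W → Decidable (CliqueIn k W)
  cliqueIn? k W S = (S ⊆? W) ×-dec isClique? G k S

  -- Ultra maximality with k = r - 2 and the real density replaced by 1/(d + 1).
  module _ {k d} (free : CliqueFree G (2 + k))
    (dense : ∀ x y → x ≢ y → ¬ x ~ y → n ^ k ≤ suc d * cliqueCount G (N G x ∩ N G y) k)
    {t} (M : BipartiteInducedMatching G t) where
    open BipartiteInducedMatching M

    cross-dense : ∀ {i j} → i ≢ j → n ^ k ≤ suc d * cliqueCount G (N G (u i) ∩ N G (v j)) k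
    cross-dense {i} {j} i≢j = dense (u i) (v j) (u≢v i j) (i≢j ∘ Equivalence.to (edge i j))

    n^k>0 : Fin t → 0 < n ^ k
    n^k>0 i = m^n>0 n {{Fin.nonZeroIndex (u i)}} k

    -- There are at most n^k cliques to choose from in N(uᵢ), and for each j in J at least n^k/(d +
    -- 1) of them lie in N(vⱼ), because uᵢ and vⱼ are distinct and not adjacent.
    pivot : ∀ i J → 0 < length J → (∀ {j} → j L.∈ J → i ≢ j) →
      ∃[ W ] CliqueIn k (N G (u i)) W × length J ≤ suc d * length (filter (λ j → W ⊆? N G (v j)) J)
    pivot i J 0<J i∉J
      with W , W∈ , large ← Averaging.popular (λ j W → W ⊆? N G (v j)) (suc d) J
             (filter (cliqueIn? k (N G (u i))) (allSubsets n)) (n^k>0 i)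
             (≤-trans (count-mono _ (λ S → ∣ S ∣ ℕ.≟ k) (proj₁ ∘ proj₂) (allSubsets n)) (count-ofSize n k))
             0<J
             (λ {j} j∈J → ≤-trans (cross-dense (i∉J j∈J)) (*-monoʳ-≤ (suc d)
               (count-filter (cliqueIn? k (N G (u i) ∩ N G (v j))) (cliqueIn? k (N G (u i))) (_⊆? N G (v j))
                 (λ (S⊆ , clique) → p∩q⊆p (N G (u i)) _ ∘ S⊆ , clique)
                 (λ (S⊆ , _) → p∩q⊆q (N G (u i)) _ ∘ S⊆) (allSubsets n))))
      = W , proj₂ (∈-filter⁻ (cliqueIn? k (N G (u i))) {xs = allSubsets n} W∈) , large

    -- Otherwise W together with the edge uᵢvᵢ would be a clique of size k + 2.
    escape : ∀ i {W} → CliqueIn k (N G (u i)) W → ∃[ w ] w ∈ W × ¬ w ~ v i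
    escape i {W} (W⊆ , clique) with Fin.any? (λ w → w ∈? W ×-dec ¬? (w ~? v i))
    ... | yes found = found
    ... | no none = contradiction
      (insert-edge clique (Equivalence.from (edge i i) refl) (∈N⁻ ∘ W⊆)
        (λ {w} w∈W → ~-sym (decidable-stable (w ~? v i) λ w≁v → none (w , w∈W , w≁v))))
      (free _)

    escape-dense : ∀ {i j w} → i ≢ j → ¬ w ~ v i → n ^ k ≤ suc d * cliqueCount G (N G w ∩ N G (v i)) k
    escape-dense {i} {j} {w} i≢j w≁v with w Fin.≟ v i
    ... | no w≢v = dense w (v i) w≢v w≁v
    -- For w = vᵢ the set N(w) ∩ N(vᵢ) is N(vᵢ), which contains N(uⱼ) ∩ N(vᵢ).
    ... | yes refl = ≤-trans (cross-dense (i≢j ∘ sym)) (*-monoʳ-≤ (suc d)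
      (count-mono _ (cliqueIn? k (N G (v i) ∩ N G (v i)))
        (λ (S⊆ , clique) → (λ x∈S → x∈p∩q⁺ (inV (S⊆ x∈S) , inV (S⊆ x∈S))) , clique) (allSubsets n)))
      where
      inV : N G (u j) ∩ N G (v i) ⊆ N G (v i)
      inV = p∩q⊆q (N G (u j)) _

    -- M stands for the cliques not yet counted. Each round removes a dense collection from M, and
    -- the invariant `contains` persists on the surviving indices.
    packing : ∀ s {M : Pred (Subset n) 0ℓ} (M? : Decidable M) J → Unique J →
      threshold (suc d) s ≤ length J →
      (∀ {j S} → j L.∈ J → CliqueIn k (N G (v j)) S → M S) →
      s * n ^ k ≤ suc d * length (filter M? (allSubsets n))
    packing zero M? J unique long contains = z≤n
    packing (suc s) M? (i ∷ []) unique (s≤s ()) contains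
    packing (suc s) {M} M? (i ∷ J@(j₀ ∷ _)) (i∉J ∷ unique) (s≤s long) contains
      with W , W-clique , large ← pivot i J (s≤s z≤n) (All.lookup i∉J)
      with w , w∈W , w≁v ← escape i W-clique
      = begin
      n ^ k + s * n ^ k
        ≤⟨ +-mono-≤ (escape-dense (All.lookup i∉J (here refl)) w≁v)
             (packing s M′? J′ (Unique.filter⁺ inN? unique) long′ contains′) ⟩
      suc d * length (filter X? Ss) + suc d * length (filter M′? Ss)
        ≡⟨ *-distribˡ-+ (suc d) (length (filter X? Ss)) _ ⟨
      suc d * (length (filter X? Ss) + length (filter M′? Ss))
        ≤⟨ *-monoʳ-≤ (suc d) (count-disjoint X? M′? M? X⊆M proj₁ (λ x (_ , ¬x) → ¬x x) Ss) ⟩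
      suc d * length (filter M? Ss) ∎
      where
      open ≤-Reasoning
      Ss = allSubsets n
      inN? : Decidable (λ j → W ⊆ N G (v j))
      inN? j = W ⊆? N G (v j)
      J′ = filter inN? J
      X? = cliqueIn? k (N G w ∩ N G (v i))
      M′? : Decidable (λ S → M S × ¬ CliqueIn k (N G w ∩ N G (v i)) S)
      M′? S = M? S ×-dec ¬? (X? S)
      X⊆M : ∀ {S} → CliqueIn k (N G w ∩ N G (v i)) S → M S
      X⊆M (S⊆ , clique) = contains (here refl) (p∩q⊆q (N G w) _ ∘ S⊆ , clique)
      long′ : threshold (suc d) s ≤ length J′
      long′ = *-cancelˡ-≤ (suc d) (≤-trans (≤-trans (n≤1+n _) long) large)
      contains′ : ∀ {j S} → j L.∈ J′ → CliqueIn k (N G (v j)) S →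
        M S × ¬ CliqueIn k (N G w ∩ N G (v i)) S
      contains′ {j} j∈ (S⊆ , clique) with j∈J , W⊆ ← ∈-filter⁻ inN? {xs = J} j∈
        = contains (there j∈J) (S⊆ , clique)
        -- Since w lies in W, it is adjacent to vⱼ; a k-clique S in N(w) and in N(vⱼ) would complete
        -- the edge wvⱼ to a clique of size k + 2.
        , λ (S⊆X , _) → free _ (insert-edge clique (~-sym (∈N⁻ (W⊆ w∈W)))
            (∈N⁻ ∘ p∩q⊆p (N G w) _ ∘ S⊆X) (∈N⁻ ∘ S⊆))

    -- Disjoint collections of size at least n^k/(d + 1) among at most n^k cliques number at most d
    -- + 1, so d + 2 rounds are impossible.
    matching-bound : t ≤ threshold (suc d) (2 + d)
    matching-bound = ≮⇒≥ λ long → overfull long (packing (2 + d)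
      (isClique? G k) (allFin t) (Unique.allFin⁺ t)
      (≤-trans (<⇒≤ long) (≤-reflexive (sym (List.length-tabulate id)))) (λ _ → proj₂))
      where
      open ≤-Reasoning
      overfull : threshold (suc d) (2 + d) < t →
        ¬ (2 + d) * n ^ k ≤ suc d * length (filter (isClique? G k) (allSubsets n))
      overfull long le = <⇒≱ (n^k>0 (Fin.fromℕ< long)) (+-cancelʳ-≤ (suc d * n ^ k) _ _ (begin
        (2 + d) * n ^ k ≤⟨ le ⟩
        suc d * length (filter (isClique? G k) (allSubsets n))
          ≤⟨ *-monoʳ-≤ (suc d) (≤-trans (count-mono _ (λ S → ∣ S ∣ ℕ.≟ k) proj₁ (allSubsets n))
               (count-ofSize n k)) ⟩
        suc d * n ^ k ∎))

-- From real to natural density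

-- For q = (p + 1)/(d + 1), clearing denominators gives (p + 1)m ≤ (d + 1)k, and m ≤ (p + 1)m.
archimedean : ∀ q → 0ℚ ℚ.< q → ∃[ d ] (∀ m k → q ℚ.* ℕ→ℚ m ℚ.≤ ℕ→ℚ k → m ≤ suc d * k)
archimedean q 0<q with q | ℚ.positive 0<q
... | mkℚ ℤ.+[1+ p ] d c | _ = d , bound
  where
  bound : ∀ m k → mkℚ ℤ.+[1+ p ] d c ℚ.* ℕ→ℚ m ℚ.≤ ℕ→ℚ k → m ≤ suc d * k
  -- In unnormalised rationals the inequality unfolds to a comparison of cross products.
  bound m k le with ℚᵘ.*≤* le′ ← ℚᵘ.≤-respʳ-≃ (ℚ.toℚᵘ-fromℚᵘ (ℚᵘ.mkℚᵘ (ℤ.+ k) 0))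
       (ℚᵘ.≤-respˡ-≃ (ℚᵘ.≃-trans (ℚ.toℚᵘ-homo-* (mkℚ ℤ.+[1+ p ] d c) (ℕ→ℚ m))
          (ℚᵘ.*-congˡ {ℚᵘ.mkℚᵘ ℤ.+[1+ p ] d} (ℚ.toℚᵘ-fromℚᵘ (ℚᵘ.mkℚᵘ (ℤ.+ m) 0)))) (ℚ.toℚᵘ-mono-≤ le))
    = ≤-trans (m≤m+n m (p * m)) (ℤ.drop‿+≤+ (subst₂ ℤ._≤_
        (trans (ℤ.*-identityʳ _) (ℤ.+◃n≡+n (suc p * m)))
        (trans (sym (ℤ.pos-* k (suc (d * 1))))
          (cong ℤ.+_ (trans (cong (λ e → k * suc e) (*-identityʳ d)) (*-comm k (suc d)))))
        le′))

ultraMaximal-matching-bound : ∀ k (α : ℝ) → Positive α →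
  ∃[ t ] (∀ {n} (G : Graph n) → UltraMaximalCliqueFree α (2 + k) G →
    ∀ s → BipartiteInducedMatching G s → s ≤ t)
ultraMaximal-matching-bound k α 0<α =
  -- Roundedness of the lower cut yields a positive rational q below α.
  let q , 0<q , q<α = Equivalence.to (ℝ.lower-rounded α 0ℚ) 0<α
      d , bound     = archimedean q 0<q
  in threshold (suc d) (2 + d) , λ {n} G (free , dense) s →
    Cliques.matching-bound G {k} {d} free λ x y x≢y x≁y →
      bound (n ^ k) (cliqueCount G (N G x ∩ N G y) k) (dense x y x≢y x≁y q q<α)

theorem1p4 : (∀ (r t : ℕ) → 3 ≤ r →
    ∃[ C ] (∀ (n : ℕ) (G : Graph n) → BipartiteInducedMatchingNumber G t →
    ∀ (𝒢 : Family (MIS G)) → All (Convex G) 𝒢 → NonemptyMembers 𝒢 →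
    Property⟨ r ,2⟩ 𝒢 →
    τ 𝒢 ≤ C))
    ×
    (∀ (r : ℕ) (α : ℝ) → 3 ≤ r → Positive α →
    ∃[ C′ ] (∀ (n : ℕ) (G : Graph n) → UltraMaximalCliqueFree α r G →
    ∀ (𝒢 : Family (MIS G)) → All (Convex G) 𝒢 → NonemptyMembers 𝒢 →
    Property⟨ r ,2⟩ 𝒢 →
    τ 𝒢 ≤ C′))
theorem1p4 =
    (λ r t _ → colours r (suc t) , λ n G (_ , bound) → Transversals.τ-bound G bound)
  -- Matching r as k + 2 lets `r ∸ 2` reduce to k.
  , λ { (suc (suc k)) α (s≤s (s≤s _)) 0<α →
        let t , bound = ultraMaximal-matching-bound k α 0<α
        in colours (2 + k) (suc t) , λ n G ultra → Transversals.τ-bound G (bound G ultra) }
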